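{- For every $n\ge 1$, the rotundus polynomial $R_n$ is cyclically invariant: as polynomials in commuting indeterminates $a_1,\dots,a_n$, $$R_n(a_1,\dots,a_n)=R_n(a_n,a_1,\dots,a_{n-1}).$$
   Context: The continuant $K_n(a_1,\dots,a_n)$ is the determinant of the $n\times n$ tridiagonal matrix with diagonal entries $a_1,\dots,a_n$, all entries immediately above and below the diagonal equal to $1$, and all other entries $0$; by convention $K_0=1$ and $K_{ -1}=0$. The rotundus is the polynomial $R_n(a_1,\dots,a_n):=K_n(a_1,\dots,a_n)-K_{n-2}(a_2,\dots,a_{n-1})$ (so $R_1(a_1)=a_1$ and $R_2(a_1,a_2)=a_1a_2-2$). -}

module Defs where

open import Algebra.Bundles.Raw using (RawRing)
open import Data.Bool using (if_then_else_)
open import Data.Fin using (Fin; zero; suc; toℕ; punchIn)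
import Data.Integer as ℤ
open ℤ using (ℤ; 0ℤ; 1ℤ)
open import Data.List using (List; []; _∷_; _++_; [_]; map; cartesianProductWith)
open import Data.Nat as ℕ using (ℕ; zero; suc; ∣_-_∣)
open import Data.Product using (_×_; _,_; map₁)
open import Data.Vec using (Vec; replicate; zipWith; _[_]≔_)
open import Data.Vec.Properties using (≡-dec)
open import Data.Vec.Functional using (Vector; init; tail)
open import Level using (0ℓ)
open import Relation.Binary.PropositionalEquality using (_≡_)
open import Relation.Nullary using (does)

module Rotundus {c ℓ} (R : RawRing c ℓ) where

  open RawRing R
  open import Algebra.Definitions.RawMonoid +-rawMonoid using (sum)
  open import Algebra.Definitions.RawSemiring rawSemiring using (_^_)

  -- Laplace expansion along the first row.
  det : ∀ {n} → (Fin n → Fin n → Carrier) → Carrier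
  det {zero}  A = 1#
  det {suc n} A = sum λ j →
    ((- 1#) ^ toℕ j) * (A zero j * det (λ i k → A (suc i) (punchIn j k)))

  tridiagonal : ∀ {n} → Vector Carrier n → Fin n → Fin n → Carrier
  tridiagonal a i j with ∣ toℕ i - toℕ j ∣
  ... | 0           = a i
  ... | 1           = 1#
  ... | suc (suc _) = 0#

  K : ∀ {n} → Vector Carrier n → Carrier
  K a = det (tridiagonal a)

  -- K_{n-2}(a₂, …, aₙ₋₁) for n = suc m; the case n = 1 is the convention K₋₁ = 0.
  innerK : ∀ {m} → Vector Carrier (suc m) → Carrier
  innerK {zero}  a = 0#
  innerK {suc m} a = K (tail (init a))

  rotundus : ∀ {m} → Vector Carrier (suc m) → Carrier
  rotundus a = K a + (- innerK a)

-- A monomial is its vector of exponents. A polynomial is a formal sum of terms,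
-- possibly with repeated monomials or zero coefficients, so equality of
-- polynomials is _≈ₚ_ (equality of all coefficients) rather than _≡_.
Monomial : ℕ → Set
Monomial n = Vec ℕ n

Poly : ℕ → Set
Poly n = List (ℤ × Monomial n)

module _ {n : ℕ} where

  coeff : Poly n → Monomial n → ℤ
  coeff []            e = 0ℤ
  coeff ((c , d) ∷ p) e =
    (if does (≡-dec ℕ._≟_ d e) then c else 0ℤ) ℤ.+ coeff p e

  infix 4 _≈ₚ_
  _≈ₚ_ : Poly n → Poly n → Set
  p ≈ₚ q = ∀ e → coeff p e ≡ coeff q e

  mulTerm : ℤ × Monomial n → ℤ × Monomial n → ℤ × Monomial n
  mulTerm (c , d) (c′ , d′) = c ℤ.* c′ , zipWith ℕ._+_ d d′

  var : Fin n → Poly n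
  var i = [ 1ℤ , replicate n 0 [ i ]≔ 1 ]

ℤ[_] : ℕ → RawRing 0ℓ 0ℓ
ℤ[ n ] = record
  { Carrier = Poly n
  ; _≈_     = _≈ₚ_
  ; _+_     = _++_
  ; _*_     = cartesianProductWith mulTerm
  ; -_      = map (map₁ (λ c → ℤ.- c))
  ; 0#      = []
  ; 1#      = [ 1ℤ , replicate n 0 ]
  }

-- In any commutative ring, expanding the continuant along the first row gives
-- K(a₁,…,aₙ) = a₁ K(a₂,…,aₙ) − K(a₃,…,aₙ), and induction gives the mirror recurrence
-- K(a₁,…,aₙ) = K(a₁,…,aₙ₋₁) aₙ − K(a₁,…,aₙ₋₂). Hence, with w = a₁,…,aₙ₋₁, both rotundi
-- equal aₙ K(w) − K(a₁,…,aₙ₋₂) − K(a₂,…,aₙ₋₁). Polynomials form such a ring: each ring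
-- law is tested against the linear extensions of functions on monomials.

module Submission where

open import Algebra.Bundles using (CommutativeRing)
open import Algebra.Bundles.Raw using (RawRing)
open import Algebra.Consequences.Setoid
  using (comm∧invˡ⇒inv; comm∧idˡ⇒id; comm∧distrʳ⇒distr)
open import Data.Bool using (if_then_else_; true; false)
open import Data.Fin using (Fin; zero; suc; toℕ; punchIn)
open import Data.Integer as ℤ using (ℤ; 0ℤ; 1ℤ)
import Data.Integer.Properties as ℤₚ
import Data.Integer.Tactic.RingSolver as ℤSolver
open import Data.List as List using ([]; _++_; map)
open import Data.List.Properties
  using (++-assoc; ++-identityʳ; cartesianProductWith-distribʳ-++)
open import Data.Nat as ℕ using (ℕ; zero; suc; ∣_-_∣)
import Data.Nat.Properties as ℕₚ
open import Data.Product using (_,_; ∃)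
open import Data.Sum using (_⊎_; inj₁; inj₂)
open import Data.Vec as Vec using (replicate; zipWith)
open import Data.Vec.Functional using (Vector; _∷_; head; init; last; tail)
open import Data.Vec.Properties
  using (≡-dec; zipWith-assoc; zipWith-comm; zipWith-identityˡ)
open import Function using (mk⇔)
open import Level using (0ℓ)
open import Relation.Binary.Bundles using (Setoid)
open import Relation.Binary.Structures using (IsEquivalence)
open import Relation.Binary.PropositionalEquality as ≡ using (_≡_; cong; cong₂)
open import Relation.Nullary using (Dec; does; no; yes)
open import Relation.Nullary.Decidable using (does-⇔; dec-false)
open import Defs

-- Determinants, continuants and rotundi over a commutative ring.

module CyclicInvariance {c ℓ} (R : CommutativeRing c ℓ) where

  open CommutativeRing R hiding (zero)
  open import Algebra.Properties.Monoid.Sum +-monoid using (sum; sum-cong-≋; sum-replicate-zero)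
  open import Algebra.Properties.Ring ring using (-1*x≈-x)
  open import Algebra.Definitions.RawSemiring (RawRing.rawSemiring rawRing) using (_^_)
  open import Relation.Binary.Reasoning.Setoid setoid
  open Rotundus rawRing

  open import Algebra.Solver.Ring.NaturalCoefficients.Default commutativeSemiring
    using (solve; _:=_; _:+_; _:*_; con)

  Matrix : ℕ → Set c
  Matrix n = Fin n → Fin n → Carrier

  minor : ∀ {n} → Matrix (suc n) → Fin (suc n) → Matrix n
  minor A j i k = A (suc i) (punchIn j k)

  det-cong : ∀ {n} {A B : Matrix n} → (∀ i j → A i j ≈ B i j) → det A ≈ det B
  det-cong {zero}  A≈B = refl
  det-cong {suc n} A≈B = sum-cong-≋ λ j → *-congˡ {(- 1#) ^ toℕ j}
    (*-cong (A≈B zero j) (det-cong λ i k → A≈B (suc i) (punchIn j k)))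

  sum-zero : ∀ {n} {t : Vector Carrier n} → (∀ i → t i ≈ 0#) → sum t ≈ 0#
  sum-zero {n} t≈0 = trans (sum-cong-≋ t≈0) (sum-replicate-zero n)

  *-zeroʳ-≈ : ∀ {x y} → y ≈ 0# → x * y ≈ 0#
  *-zeroʳ-≈ y≈0 = trans (*-congˡ y≈0) (zeroʳ _)

  -- Deleting row 0 and a later column keeps column 0, so every minor after the first has a zero
  -- first column, and by induction its determinant vanishes.
  det-firstColumn : ∀ {n} (A : Matrix (suc n)) → (∀ i → A (suc i) zero ≈ 0#) →
    det A ≈ A zero zero * det (minor A zero)
  det-firstColumn {zero}  A A≈0 = trans (+-identityʳ _) (*-identityˡ _)
  det-firstColumn {suc n} A A≈0 = trans (+-cong (*-identityˡ _) (sum-zero laterTerm)) (+-identityʳ _)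
    where
    laterTerm : ∀ j → (- 1#) ^ toℕ (suc j) * (A zero (suc j) * det (minor A (suc j))) ≈ 0#
    laterTerm j = *-zeroʳ-≈ (*-zeroʳ-≈ (begin
      det M                           ≈⟨ det-firstColumn M (λ i → A≈0 (suc i)) ⟩
      M zero zero * det (minor M zero) ≈⟨ *-congʳ (A≈0 zero) ⟩
      0# * det (minor M zero)         ≈⟨ zeroˡ _ ⟩
      0#                              ∎))
      where M = minor A (suc j)

  tridiagonal-tail : ∀ {n} (a : Vector Carrier (suc n)) →
    ∀ i j → tridiagonal a (suc i) (suc j) ≈ tridiagonal (tail a) i j
  tridiagonal-tail a i j with ∣ toℕ i - toℕ j ∣
  ... | 0           = refl
  ... | 1           = refl
  ... | suc (suc _) = refl

  K-singleton : (a : Vector Carrier 1) → K a ≈ head a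
  K-singleton a = trans (+-identityʳ _) (trans (*-identityˡ _) (*-identityʳ _))

  -- The signs are kept as products with - 1#, so that the rearrangements below
  -- are identities of commutative semirings.
  K-left : ∀ {n} (a : Vector Carrier (2 ℕ.+ n)) →
    K a ≈ head a * K (tail a) + - 1# * K (tail (tail a))
  K-left a = begin
    K a
      ≈⟨ +-cong (*-identityˡ _) (trans (+-cong (*-cong (*-identityʳ _) (*-identityˡ _)) (sum-zero laterTerm)) (+-identityʳ _)) ⟩
    head a * det (minor T zero) + - 1# * det M
      -- Column 0 of `M` is 1, 0, ..., 0, so only its top left minor survives: `T` without its first
      -- two rows and columns.
      ≈⟨ +-cong (*-congˡ (det-cong (tridiagonal-tail a))) (*-congˡ (det-firstColumn M λ _ → refl)) ⟩
    head a * K (tail a) + - 1# * (1# * det (minor M zero))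
      ≈⟨ +-congˡ (*-congˡ (trans (*-identityˡ _) (det-cong λ i j →
           trans (tridiagonal-tail a (suc i) (suc j)) (tridiagonal-tail (tail a) i j)))) ⟩
    head a * K (tail a) + - 1# * K (tail (tail a)) ∎
    where
    T = tridiagonal a
    M = minor T (suc zero)
    laterTerm : ∀ j → (- 1#) ^ toℕ (suc (suc j)) *
      (T zero (suc (suc j)) * det (minor T (suc (suc j)))) ≈ 0#
    laterTerm j = *-zeroʳ-≈ (zeroˡ _)

  -- Two-step induction: the recurrence is applied to both continuants produced by `K-left`, and the
  -- regrouped products fold back by `K-left`. As `tail (tail a)` then needs length at least 2,
  -- lengths 2 and 3 are separate cases. `init` and `tail` commute by computation.
  K-right : ∀ {n} (a : Vector Carrier (2 ℕ.+ n)) →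
    K a ≈ K (init a) * last a + - 1# * K (init (init a))
  K-right {zero} a = begin
    K a                             ≈⟨ K-left a ⟩
    head a * K (tail a) + - 1# * 1# ≈⟨ +-congʳ (*-cong (sym (K-singleton (init a))) (K-singleton (tail a))) ⟩
    K (init a) * last a + - 1# * 1# ∎
  K-right {suc zero} a = begin
    K a
      ≈⟨ K-left a ⟩
    x * K (tail a) + - 1# * K (tail (tail a))
      -- Here `tail (tail a)` has length 1, too short for the recurrence. The new `1#` is the
      -- continuant of the empty vector.
      ≈⟨ +-cong (*-congˡ (K-right (tail a))) (*-congˡ (K-singleton (tail (tail a)))) ⟩
    x * (K (tail (init a)) * z + - 1# * 1#) + - 1# * z
      ≈⟨ solve 4 (λ x z p ε → x :* (p :* z :+ ε :* con 1) :+ ε :* z :=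
           (x :* p :+ ε :* con 1) :* z :+ ε :* x) refl x z (K (tail (init a))) (- 1#) ⟩
    (x * K (tail (init a)) + - 1# * 1#) * z + - 1# * x
      ≈⟨ +-cong (*-congʳ (sym (K-left (init a)))) (*-congˡ (sym (K-singleton (init (init a))))) ⟩
    K (init a) * z + - 1# * K (init (init a)) ∎
    where
    x = head a
    z = last a
  K-right {suc (suc n)} a = begin
    K a
      ≈⟨ K-left a ⟩
    x * K (tail a) + - 1# * K (tail (tail a))
      ≈⟨ +-cong (*-congˡ (K-right (tail a))) (*-congˡ (K-right (tail (tail a)))) ⟩
    x * (p * z + - 1# * q) + - 1# * (r * z + - 1# * s)
      ≈⟨ solve 7 (λ x z p q r s ε →
           x :* (p :* z :+ ε :* q) :+ ε :* (r :* z :+ ε :* s) :=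
           (x :* p :+ ε :* r) :* z :+ ε :* (x :* q :+ ε :* s)) refl x z p q r s (- 1#) ⟩
    (x * p + - 1# * r) * z + - 1# * (x * q + - 1# * s)
      ≈⟨ +-cong (*-congʳ (sym (K-left (init a)))) (*-congˡ (sym (K-left (init (init a))))) ⟩
    K (init a) * z + - 1# * K (init (init a)) ∎
    where
    x = head a
    z = last a
    p = K (tail (init a))
    q = K (tail (init (init a)))
    r = K (tail (tail (init a)))
    s = K (tail (tail (init (init a))))

  rotundus-cyclic : ∀ {m} (a : Vector Carrier (suc m)) →
    rotundus a ≈ rotundus (last a ∷ init a)
  -- Both inner continuants are the convention value `0#`, and rotation fixes the only entry.
  rotundus-cyclic {zero}  a = +-congʳ (trans (K-singleton a) (sym (K-singleton (last a ∷ init a))))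
  rotundus-cyclic {suc m} a = begin
    K a - q
      ≈⟨ +-cong (K-right a) (sym (-1*x≈-x q)) ⟩
    (k * z + - 1# * p) + - 1# * q
      ≈⟨ solve 5 (λ k z p q ε → (k :* z :+ ε :* p) :+ ε :* q :=
           (z :* k :+ ε :* q) :+ ε :* p) refl k z p q (- 1#) ⟩
    (z * k + - 1# * q) + - 1# * p
      -- For the rotated vector the roles are exchanged: `q` now comes from the recurrence and `p`
      -- is the inner continuant.
      ≈⟨ +-cong (sym (K-left (z ∷ init a))) (-1*x≈-x p) ⟩
    K (z ∷ init a) - p ∎
    where
    k = K (init a)
    z = last a
    p = K (init (init a))
    q = K (tail (init a))

-- Integer polynomials as a commutative ring.

module PolynomialRing (n : ℕ) where

  open ≡.≡-Reasoning
  open RawRing ℤ[ n ] using () renaming (_*_ to _*ₚ_; -_ to -ₚ_; 1# to 1ₚ)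

  infixl 6 _+ₘ_ _∸ₘ_
  _+ₘ_ _∸ₘ_ : Monomial n → Monomial n → Monomial n
  _+ₘ_ = zipWith ℕ._+_
  _∸ₘ_ = zipWith ℕ._∸_

  infix 4 _≟ₘ_
  _≟ₘ_ : (d e : Monomial n) → Dec (d ≡ e)
  _≟ₘ_ = ≡-dec ℕ._≟_

  -- The linear extension of `φ` to formal sums. It is not substitution of values: `φ` need not be
  -- multiplicative.
  eval : (Monomial n → ℤ) → Poly n → ℤ
  eval φ []                  = 0ℤ
  eval φ ((c , d) List.∷ p) = c ℤ.* φ d ℤ.+ eval φ p

  δ : Monomial n → Monomial n → ℤ
  δ e d = if does (d ≟ₘ e) then 1ℤ else 0ℤ

  coeff-eval : ∀ p e → coeff p e ≡ eval (δ e) p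
  coeff-eval []                  e = ≡.refl
  coeff-eval ((c , d) List.∷ p) e = cong₂ ℤ._+_ (scale (does (d ≟ₘ e))) (coeff-eval p e)
    where
    scale : ∀ b → (if b then c else 0ℤ) ≡ c ℤ.* (if b then 1ℤ else 0ℤ)
    scale true  = ≡.sym (ℤₚ.*-identityʳ c)
    scale false = ≡.sym (ℤₚ.*-zeroʳ c)

  -- Coefficients are the functionals of the `δ e`. Testing against every `φ` leaves room for
  -- products, which replace `φ` by translates and partial sums that need not be of the form `δ e`.
  eval⇒≈ : ∀ p q → (∀ φ → eval φ p ≡ eval φ q) → p ≈ₚ q
  eval⇒≈ p q p≡q e =
    ≡.trans (coeff-eval p e) (≡.trans (p≡q (δ e)) (≡.sym (coeff-eval q e)))

  eval-cong : ∀ {φ ψ} → (∀ d → φ d ≡ ψ d) → ∀ p → eval φ p ≡ eval ψ p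
  eval-cong φ≡ψ []                  = ≡.refl
  eval-cong φ≡ψ ((c , d) List.∷ p) = cong₂ ℤ._+_ (cong (c ℤ.*_) (φ≡ψ d)) (eval-cong φ≡ψ p)

  eval-zero : ∀ p → eval (λ _ → 0ℤ) p ≡ 0ℤ
  eval-zero []                  = ≡.refl
  eval-zero ((c , d) List.∷ p) = cong₂ ℤ._+_ (ℤₚ.*-zeroʳ c) (eval-zero p)

  eval-linear : ∀ c φ ψ p → eval (λ d → c ℤ.* φ d ℤ.+ ψ d) p ≡ c ℤ.* eval φ p ℤ.+ eval ψ p
  eval-linear c φ ψ []                   = ≡.sym (≡.trans (ℤₚ.+-identityʳ _) (ℤₚ.*-zeroʳ c))
  eval-linear c φ ψ ((c′ , d) List.∷ p) = begin
    c′ ℤ.* (c ℤ.* φ d ℤ.+ ψ d) ℤ.+ eval (λ d → c ℤ.* φ d ℤ.+ ψ d) p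
      ≡⟨ cong (ℤ._+_ (c′ ℤ.* (c ℤ.* φ d ℤ.+ ψ d))) (eval-linear c φ ψ p) ⟩
    c′ ℤ.* (c ℤ.* φ d ℤ.+ ψ d) ℤ.+ (c ℤ.* eval φ p ℤ.+ eval ψ p)
      ≡⟨ rearrange c c′ (φ d) (ψ d) (eval φ p) (eval ψ p) ⟩
    c ℤ.* (c′ ℤ.* φ d ℤ.+ eval φ p) ℤ.+ (c′ ℤ.* ψ d ℤ.+ eval ψ p) ∎
    where
    rearrange : ∀ c c′ x y u v →
      c′ ℤ.* (c ℤ.* x ℤ.+ y) ℤ.+ (c ℤ.* u ℤ.+ v) ≡ c ℤ.* (c′ ℤ.* x ℤ.+ u) ℤ.+ (c′ ℤ.* y ℤ.+ v)
    rearrange = ℤSolver.solve-∀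

  -- Exchange of two finite sums. Each term split off from `p` is moved inside the sum over `q` by
  -- linearity in the function, `eval-linear`.
  eval-swap : ∀ (φ : Monomial n → Monomial n → ℤ) p q →
    eval (λ d → eval (φ d) q) p ≡ eval (λ d′ → eval (λ d → φ d d′) p) q
  eval-swap φ []                  q = ≡.sym (eval-zero q)
  eval-swap φ ((c , d) List.∷ p) q = ≡.trans (cong (ℤ._+_ (c ℤ.* eval (φ d) q)) (eval-swap φ p q))
    (≡.sym (eval-linear c (φ d) (λ d′ → eval (λ d → φ d d′) p) q))

  eval-++ : ∀ φ p q → eval φ (p ++ q) ≡ eval φ p ℤ.+ eval φ q
  eval-++ φ []                  q = ≡.sym (ℤₚ.+-identityˡ _)
  eval-++ φ ((c , d) List.∷ p) q =
    ≡.trans (cong (ℤ._+_ (c ℤ.* φ d)) (eval-++ φ p q)) (≡.sym (ℤₚ.+-assoc (c ℤ.* φ d) _ _))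

  eval-neg : ∀ φ p → eval φ (-ₚ p) ≡ ℤ.- eval φ p
  eval-neg φ []                  = ≡.refl
  eval-neg φ ((c , d) List.∷ p) = ≡.trans
    (cong₂ ℤ._+_ (≡.sym (ℤₚ.neg-distribˡ-* c (φ d))) (eval-neg φ p))
    (≡.sym (ℤₚ.neg-distrib-+ (c ℤ.* φ d) (eval φ p)))

  eval-mulTerm : ∀ φ c d q →
    eval φ (map (mulTerm (c , d)) q) ≡ c ℤ.* eval (λ d′ → φ (d +ₘ d′)) q
  eval-mulTerm φ c d []                    = ≡.sym (ℤₚ.*-zeroʳ c)
  eval-mulTerm φ c d ((c′ , d′) List.∷ q) = ≡.trans
    (cong₂ ℤ._+_ (ℤₚ.*-assoc c c′ _) (eval-mulTerm φ c d q))
    (≡.sym (ℤₚ.*-distribˡ-+ c _ _))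

  -- A product becomes an iterated sum over exponents, so that laws of multiplication reduce to laws
  -- of `_+ₘ_`.
  eval-* : ∀ φ p q → eval φ (p *ₚ q) ≡ eval (λ d → eval (λ d′ → φ (d +ₘ d′)) q) p
  eval-* φ []                  q = ≡.refl
  eval-* φ ((c , d) List.∷ p) q = ≡.trans (eval-++ φ (map (mulTerm (c , d)) q) _)
    (cong₂ ℤ._+_ (eval-mulTerm φ c d q) (eval-* φ p q))

  +ₘ-∸ₘ : ∀ d d′ → d +ₘ d′ ∸ₘ d ≡ d′
  -- The length `n` is fixed by the module, so the induction runs over an arbitrary length `k`.
  +ₘ-∸ₘ = go
    where
    go : ∀ {k} (d d′ : Monomial k) → zipWith ℕ._∸_ (zipWith ℕ._+_ d d′) d ≡ d′
    go Vec.[]       Vec.[]         = ≡.refl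
    go (x Vec.∷ d) (y Vec.∷ d′) = cong₂ Vec._∷_ (ℕₚ.m+n∸m≡n x y) (go d d′)

  -- The coefficient of xᵉ in xᵈ q is either a coefficient of q or zero, so that
  -- multiplication respects _≈ₚ_.
  δ-shift : ∀ e d →
    (∃ λ k → ∀ d′ → δ e (d +ₘ d′) ≡ δ k d′) ⊎ (∀ d′ → δ e (d +ₘ d′) ≡ 0ℤ)
  -- The truncated difference `e ∸ₘ d` is the only candidate for the cofactor exponent; adding `d`
  -- back tests whether the monomial `d` divides `e`.
  δ-shift e d with d +ₘ (e ∸ₘ d) ≟ₘ e
  ... | yes d+k≡e = inj₁ (e ∸ₘ d , λ d′ → cong (if_then 1ℤ else 0ℤ) (does-⇔
    (mk⇔ (λ { ≡.refl → ≡.sym (+ₘ-∸ₘ d d′) }) (λ { ≡.refl → d+k≡e }))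
    (d +ₘ d′ ≟ₘ e) (d′ ≟ₘ e ∸ₘ d)))
  ... | no d+k≢e = inj₂ λ d′ → cong (if_then 1ℤ else 0ℤ) (dec-false (d +ₘ d′ ≟ₘ e)
    λ { ≡.refl → d+k≢e (cong (d +ₘ_) (+ₘ-∸ₘ d d′)) })

  -- The hypothesis concerns coefficients only, so `q` can be exchanged for `q′` only under some
  -- `δ k`. By `δ-shift` each inner function is such a `δ k` or zero.
  *-congˡ : ∀ p {q q′} → q ≈ₚ q′ → p *ₚ q ≈ₚ p *ₚ q′
  *-congˡ p {q} {q′} q≈q′ e = begin
    coeff (p *ₚ q) e                                  ≡⟨ coeff-eval (p *ₚ q) e ⟩
    eval (δ e) (p *ₚ q)                               ≡⟨ eval-* (δ e) p q ⟩
    eval (λ d → eval (λ d′ → δ e (d +ₘ d′)) q) p     ≡⟨ eval-cong shifted p ⟩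
    eval (λ d → eval (λ d′ → δ e (d +ₘ d′)) q′) p    ≡⟨ eval-* (δ e) p q′ ⟨
    eval (δ e) (p *ₚ q′)                              ≡⟨ coeff-eval (p *ₚ q′) e ⟨
    coeff (p *ₚ q′) e                                 ∎
    where
    shifted : ∀ d → eval (λ d′ → δ e (d +ₘ d′)) q ≡ eval (λ d′ → δ e (d +ₘ d′)) q′
    shifted d with δ-shift e d
    ... | inj₁ (k , eq) = begin
      eval (λ d′ → δ e (d +ₘ d′)) q   ≡⟨ eval-cong eq q ⟩
      eval (δ k) q                     ≡⟨ coeff-eval q k ⟨
      coeff q k                        ≡⟨ q≈q′ k ⟩
      coeff q′ k                       ≡⟨ coeff-eval q′ k ⟩
      eval (δ k) q′                    ≡⟨ eval-cong eq q′ ⟨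
      eval (λ d′ → δ e (d +ₘ d′)) q′  ∎
    ... | inj₂ eq = begin
      eval (λ d′ → δ e (d +ₘ d′)) q   ≡⟨ eval-cong eq q ⟩
      eval (λ _ → 0ℤ) q                ≡⟨ eval-zero q ⟩
      0ℤ                               ≡⟨ eval-zero q′ ⟨
      eval (λ _ → 0ℤ) q′               ≡⟨ eval-cong eq q′ ⟨
      eval (λ d′ → δ e (d +ₘ d′)) q′  ∎

  -- Remaining laws of the polynomial ring.

  coeff-++ : ∀ p q e → coeff (p ++ q) e ≡ coeff p e ℤ.+ coeff q e
  coeff-++ p q e = begin
    coeff (p ++ q) e                  ≡⟨ coeff-eval (p ++ q) e ⟩
    eval (δ e) (p ++ q)               ≡⟨ eval-++ (δ e) p q ⟩
    eval (δ e) p ℤ.+ eval (δ e) q     ≡⟨ cong₂ ℤ._+_ (coeff-eval p e) (coeff-eval q e) ⟨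
    coeff p e ℤ.+ coeff q e           ∎

  coeff-neg : ∀ p e → coeff (-ₚ p) e ≡ ℤ.- coeff p e
  coeff-neg p e = begin
    coeff (-ₚ p) e      ≡⟨ coeff-eval (-ₚ p) e ⟩
    eval (δ e) (-ₚ p)   ≡⟨ eval-neg (δ e) p ⟩
    ℤ.- eval (δ e) p    ≡⟨ cong ℤ.-_ (coeff-eval p e) ⟨
    ℤ.- coeff p e       ∎

  +-cong : ∀ {p p′ q q′} → p ≈ₚ p′ → q ≈ₚ q′ → p ++ q ≈ₚ p′ ++ q′
  +-cong {p} {p′} {q} {q′} p≈p′ q≈q′ e = begin
    coeff (p ++ q) e            ≡⟨ coeff-++ p q e ⟩
    coeff p e ℤ.+ coeff q e     ≡⟨ cong₂ ℤ._+_ (p≈p′ e) (q≈q′ e) ⟩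
    coeff p′ e ℤ.+ coeff q′ e   ≡⟨ coeff-++ p′ q′ e ⟨
    coeff (p′ ++ q′) e          ∎

  +-comm : ∀ p q → p ++ q ≈ₚ q ++ p
  +-comm p q e = begin
    coeff (p ++ q) e          ≡⟨ coeff-++ p q e ⟩
    coeff p e ℤ.+ coeff q e   ≡⟨ ℤₚ.+-comm (coeff p e) (coeff q e) ⟩
    coeff q e ℤ.+ coeff p e   ≡⟨ coeff-++ q p e ⟨
    coeff (q ++ p) e          ∎

  -‿cong : ∀ {p q} → p ≈ₚ q → -ₚ p ≈ₚ -ₚ q
  -‿cong {p} {q} p≈q e = begin
    coeff (-ₚ p) e   ≡⟨ coeff-neg p e ⟩
    ℤ.- coeff p e    ≡⟨ cong ℤ.-_ (p≈q e) ⟩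
    ℤ.- coeff q e    ≡⟨ coeff-neg q e ⟨
    coeff (-ₚ q) e   ∎

  -‿inverseˡ : ∀ p → (-ₚ p) ++ p ≈ₚ []
  -‿inverseˡ p e = begin
    coeff ((-ₚ p) ++ p) e           ≡⟨ coeff-++ (-ₚ p) p e ⟩
    coeff (-ₚ p) e ℤ.+ coeff p e    ≡⟨ cong (ℤ._+ coeff p e) (coeff-neg p e) ⟩
    ℤ.- coeff p e ℤ.+ coeff p e     ≡⟨ ℤₚ.+-inverseˡ (coeff p e) ⟩
    0ℤ                              ∎

  *-comm : ∀ p q → p *ₚ q ≈ₚ q *ₚ p
  *-comm p q = eval⇒≈ (p *ₚ q) (q *ₚ p) λ φ → begin
    eval φ (p *ₚ q)                               ≡⟨ eval-* φ p q ⟩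
    eval (λ d → eval (λ d′ → φ (d +ₘ d′)) q) p   ≡⟨ eval-swap (λ d d′ → φ (d +ₘ d′)) p q ⟩
    eval (λ d′ → eval (λ d → φ (d +ₘ d′)) p) q   ≡⟨ eval-cong (λ d′ → eval-cong (λ d →
                                                       cong φ (zipWith-comm ℕₚ.+-comm d d′)) p) q ⟩
    eval (λ d′ → eval (λ d → φ (d′ +ₘ d)) p) q   ≡⟨ eval-* φ q p ⟨
    eval φ (q *ₚ p)                               ∎

  *-cong : ∀ {p p′ q q′} → p ≈ₚ p′ → q ≈ₚ q′ → p *ₚ q ≈ₚ p′ *ₚ q′
  *-cong {p} {p′} {q} {q′} p≈p′ q≈q′ e = begin
    coeff (p *ₚ q) e     ≡⟨ *-congˡ p q≈q′ e ⟩
    coeff (p *ₚ q′) e    ≡⟨ *-comm p q′ e ⟩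
    coeff (q′ *ₚ p) e    ≡⟨ *-congˡ q′ p≈p′ e ⟩
    coeff (q′ *ₚ p′) e   ≡⟨ *-comm q′ p′ e ⟩
    coeff (p′ *ₚ q′) e   ∎

  *-assoc : ∀ p q r → (p *ₚ q) *ₚ r ≈ₚ p *ₚ (q *ₚ r)
  *-assoc p q r = eval⇒≈ ((p *ₚ q) *ₚ r) (p *ₚ (q *ₚ r)) λ φ → begin
    eval φ ((p *ₚ q) *ₚ r)
      ≡⟨ eval-* φ (p *ₚ q) r ⟩
    eval (λ d → eval (λ d″ → φ (d +ₘ d″)) r) (p *ₚ q)
      -- The sum over `r` is itself a function of the monomial `d`, so the product formula applies
      -- again.
      ≡⟨ eval-* _ p q ⟩
    eval (λ d → eval (λ d′ → eval (λ d″ → φ ((d +ₘ d′) +ₘ d″)) r) q) p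
      ≡⟨ eval-cong (λ d → eval-cong (λ d′ → eval-cong (λ d″ →
           cong φ (zipWith-assoc ℕₚ.+-assoc d d′ d″)) r) q) p ⟩
    eval (λ d → eval (λ d′ → eval (λ d″ → φ (d +ₘ (d′ +ₘ d″))) r) q) p
      ≡⟨ eval-cong (λ d → eval-* (λ x → φ (d +ₘ x)) q r) p ⟨
    eval (λ d → eval (λ x → φ (d +ₘ x)) (q *ₚ r)) p
      ≡⟨ eval-* φ p (q *ₚ r) ⟨
    eval φ (p *ₚ (q *ₚ r)) ∎

  *-identityˡ : ∀ p → 1ₚ *ₚ p ≈ₚ p
  *-identityˡ p = eval⇒≈ (1ₚ *ₚ p) p λ φ → begin
    eval φ (1ₚ *ₚ p)                                          ≡⟨ eval-* φ 1ₚ p ⟩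
    1ℤ ℤ.* eval (λ d → φ (replicate n 0 +ₘ d)) p ℤ.+ 0ℤ   ≡⟨ ℤₚ.+-identityʳ _ ⟩
    1ℤ ℤ.* eval (λ d → φ (replicate n 0 +ₘ d)) p            ≡⟨ ℤₚ.*-identityˡ _ ⟩
    eval (λ d → φ (replicate n 0 +ₘ d)) p                    ≡⟨ eval-cong (λ d →
                                                                   cong φ (zipWith-identityˡ ℕₚ.+-identityˡ d)) p ⟩
    eval φ p                                                  ∎

  -- On this side the two lists of terms coincide, order included. The other distributive law is
  -- obtained from commutativity.
  *-distribʳ-+ : ∀ r p q → (p ++ q) *ₚ r ≈ₚ (p *ₚ r) ++ (q *ₚ r)
  *-distribʳ-+ r p q e = cong (λ s → coeff s e) (cartesianProductWith-distribʳ-++ mulTerm p q r)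

  ≈ₚ-isEquivalence : IsEquivalence (_≈ₚ_ {n})
  ≈ₚ-isEquivalence = record
    { refl  = λ _ → ≡.refl
    ; sym   = λ p≈q e → ≡.sym (p≈q e)
    ; trans = λ p≈q q≈r e → ≡.trans (p≈q e) (q≈r e)
    }

  ≈ₚ-setoid : Setoid 0ℓ 0ℓ
  ≈ₚ-setoid = record { isEquivalence = ≈ₚ-isEquivalence }

  commutativeRing : CommutativeRing 0ℓ 0ℓ
  commutativeRing = record
    { _+_ = _++_ ; _*_ = _*ₚ_ ; -_ = -ₚ_ ; 0# = [] ; 1# = 1ₚ
    ; isCommutativeRing = record
      { isRing = record
        { +-isAbelianGroup = record
          { isGroup = record
            { isMonoid = record
              { isSemigroup = record
                { isMagma = record
                  { isEquivalence = ≈ₚ-isEquivalence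
                  ; ∙-cong        = λ {p} {p′} {q} {q′} → +-cong {p} {p′} {q} {q′}
                  }
                ; assoc = λ p q r e → cong (λ s → coeff s e) (++-assoc p q r)
                }
              ; identity = (λ _ _ → ≡.refl) , λ p e → cong (λ s → coeff s e) (++-identityʳ p)
              }
            ; inverse = comm∧invˡ⇒inv ≈ₚ-setoid {_∙_ = _++_} {_⁻¹ = -ₚ_} {e = []} +-comm -‿inverseˡ
            ; ⁻¹-cong = λ {p} {q} → -‿cong {p} {q}
            }
          ; comm = +-comm
          }
        ; *-cong     = λ {p} {p′} {q} {q′} → *-cong {p} {p′} {q} {q′}
        ; *-assoc    = *-assoc
        ; *-identity = comm∧idˡ⇒id ≈ₚ-setoid {_∙_ = _*ₚ_} *-comm {e = 1ₚ} *-identityˡ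
        ; distrib    = comm∧distrʳ⇒distr ≈ₚ-setoid {_∙_ = _*ₚ_} {_◦_ = _++_}
            (λ {p} {p′} {q} {q′} → +-cong {p} {p′} {q} {q′}) *-comm *-distribʳ-+
        }
      ; *-comm = *-comm
      }
    }

proposition1 : (m : ℕ) → let open Rotundus ℤ[ suc m ] in rotundus var ≈ₚ rotundus (last var ∷ init var)
-- The raw ring underlying this commutative ring has the same operations and equality as
-- `ℤ[ suc m ]`, so the two rotundi are those of the statement.
proposition1 m = CyclicInvariance.rotundus-cyclic (PolynomialRing.commutativeRing (suc m)) var
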